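{- Let $\widehat{X}$ be a sandpile graph whose sink has no outgoing edges, and let $e\in\mathcal{M}(\widehat{X})$ be an idempotent with $e\neq0$. Then $$G_e=\{g\oplus j:\ g,j\in\mathcal{M}(\widehat{X}),\ g\text{ is recurrent in the sandpile monoid of }\iota(\operatorname{supp}(e)),\ \operatorname{supp}(j)\subseteq A(e)\}.$$
   Context: A sandpile graph $\widehat{X}$ is a finite weakly connected directed multigraph (loops and multiple edges allowed) with a distinguished vertex, the sink, reachable by a directed path from every vertex; the set $V$ of non-sink vertices is nonempty, and $X$ is the digraph obtained by deleting the sink. A configuration assigns a nonnegative integer number of grains to each non-sink vertex; it is stable if every $v$ holds fewer than $\deg^{+}(v)$ (out-degree) grains. Toppling an unstable vertex sends one grain along each of its out-edges (grains at the sink vanish; the sink never topples); every configuration has a unique stabilization. $\mathcal{M}(\widehat X)$ is the set of stable configurations with $a\oplus b$ = stabilization of $a+b$ (commutative monoid, identity $0$). $a$ is accessible from $b$ if $b\oplus x=a$ for some $x$; $a$ is recurrent if accessible from every element. For an idempotent $e$, $G_e$ is the unique maximal subgroup of $\mathcal M(\widehat X)$ with identity $e$. $\operatorname{supp}(m)$ is the set of vertices holding at least one grain. A cycle is a directed closed path of length $\ge1$ in $X$. For $W\subseteq V$, $\operatorname{cl}(W)$ is the set of $z\in V$ reachable by a (possibly trivial) directed path in $X$ from some $w\in W$. For nonempty $S\subseteq V$, $\iota(S)$ is the subgraph of $\widehat X$ induced on $\operatorname{cl}(S)\cup\{\text{sink}\}$, with edges those of $\widehat X$ whose tail lies in this set;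 it is itself a sandpile graph, and its stable configurations are identified with configurations of $\widehat X$ vanishing outside $\operatorname{cl}(S)$. A strongly connected component is a maximal subset of $V$ whose vertices mutually reach each other by paths in $X$; it is cyclic if it contains a cycle. A vertex is acyclic if it lies on no cycle. $A(e)$ is the set of acyclic vertices $v\in V$ with $v\notin\operatorname{cl}(\operatorname{supp}(e))$ such that every cyclic strongly connected component reachable from $v$ by a path in $X$ intersects $\operatorname{supp}(e)$. -}

module Defs where

open import Level using (Level; 0ℓ) renaming (suc to lsuc)
open import Data.Nat using (ℕ; zero; suc; _+_; _∸_; _≤_; _<_)
open import Data.Fin using (Fin; _≟_)
open import Data.Vec using (Vec; lookup; tabulate; zipWith; replicate; sum)
open import Data.Bool using (if_then_else_)
open import Data.Product using (Σ; ∃; _×_; _,_)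
open import Data.Unit using (⊤)
open import Relation.Nullary using (¬_)
open import Relation.Nullary.Decidable using (⌊_⌋)
open import Relation.Binary.PropositionalEquality using (_≡_)

-- Sandpile graphs whose sink has no outgoing edges.
-- Non-sink vertices are Fin n.  adj v w = number of edges v → w
-- (loops allowed: adj v v), sinkE v = number of edges v → sink.
-- The sink has no out-edges, so this data determines the multigraph.

record Graph (n : ℕ) : Set where
  field
    adj   : Fin n → Fin n → ℕ
    sinkE : Fin n → ℕ
open Graph public

Config : ℕ → Set
Config n = Vec ℕ n

_⊞_ : ∀ {n} → Config n → Config n → Config n
a ⊞ b = zipWith _+_ a b

zeroC : ∀ n → Config n
zeroC n = replicate n 0

Pred : ℕ → Set₁
Pred n = Fin n → Set

module _ {n : ℕ} (G : Graph n) where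

  deg : Fin n → ℕ
  deg v = sum (tabulate (adj G v)) + sinkE G v

  Edge : Fin n → Fin n → Set
  Edge v w = 0 < adj G v w

  data Reach : Fin n → Fin n → Set where
    here : ∀ {v} → Reach v v
    step : ∀ {v u w} → Edge v u → Reach u w → Reach v w

  data ReachSink : Fin n → Set where
    direct : ∀ {v} → 0 < sinkE G v → ReachSink v
    via    : ∀ {v u} → Edge v u → ReachSink u → ReachSink v

  -- sandpile graph axioms (V nonempty, sink reachable from every vertex;
  -- weak connectivity follows from the latter)
  IsSandpileGraph : Set
  IsSandpileGraph = (0 < n) × (∀ v → ReachSink v)

  cl : Pred n → Pred n
  cl W z = ∃ λ w → W w × Reach w z

  OnCycle : Fin n → Set
  OnCycle v = ∃ λ u → Edge v u × Reach u v

  SameSCC : Fin n → Fin n → Set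
  SameSCC u w = Reach u w × Reach w u

  CyclicSCCof : Fin n → Set
  CyclicSCCof u = ∃ λ w → SameSCC u w × OnCycle w

  -- Sandpile dynamics on the sandpile graph induced on U ∪ {sink}, for a
  -- set U ⊆ V closed under reachability (U = everything gives X̂ itself,
  -- U = cl(S) gives ι(S), with configurations of ι(S) identified with
  -- configurations vanishing outside U).  Since U is closed, every out-edge
  -- of a vertex of U ends in U ∪ {sink}, so out-degrees agree with deg.

  topple : Fin n → Config n → Config n
  topple v c = tabulate λ w →
    (if ⌊ w ≟ v ⌋ then lookup c w ∸ deg v else lookup c w) + adj G v w

  Supported : Pred n → Config n → Set
  Supported U c = ∀ v → ¬ U v → lookup c v ≡ 0

  StableOn : Pred n → Config n → Set
  StableOn U c = ∀ v → U v → lookup c v < deg v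

  StableIn : Pred n → Config n → Set
  StableIn U c = Supported U c × StableOn U c

  data Stab (U : Pred n) : Config n → Config n → Set where
    done : ∀ {c} → StableOn U c → Stab U c c
    fire : ∀ {c s} v → U v → deg v ≤ lookup c v →
           Stab U (topple v c) s → Stab U c s

  All : Pred n
  All _ = ⊤

  Oplus : Config n → Config n → Config n → Set
  Oplus a b s = Stab All (a ⊞ b) s

  M : Config n → Set
  M = StableIn All

  Idempotent : Config n → Set
  Idempotent e = M e × Oplus e e e

  IsSubgroupWithId : Config n → (Config n → Set) → Set
  IsSubgroupWithId e H =
      (∀ x → H x → M x)
    × H e
    × (∀ x y z → H x → H y → Oplus x y z → H z)
    × (∀ x → H x → Oplus x e x)
    × (∀ x → H x → ∃ λ y → H y × Oplus x y e)

  IsMaximalSubgroupWithId : Config n → (Config n → Set) → Set₁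
  IsMaximalSubgroupWithId e H =
    IsSubgroupWithId e H ×
    (∀ H' → IsSubgroupWithId e H' → ∀ x → H' x → H x)

  supp : Config n → Pred n
  supp m v = 0 < lookup m v

  RecurrentIn : Pred n → Config n → Set
  RecurrentIn U g =
    StableIn U g ×
    (∀ b → StableIn U b → ∃ λ x → StableIn U x × Stab U (b ⊞ x) g)

  A : Config n → Pred n
  A e v =
      ¬ OnCycle v
    × ¬ cl (supp e) v
    × (∀ u → Reach v u → CyclicSCCof u → ∃ λ w → SameSCC u w × supp e w)

{-# OPTIONS --safe #-}

-- Stabilizations exist because some weight on the vertices strictly decreases
-- along every toppling, and they are unique because legal topplings commute;
-- so M is the commutative monoid of configurations modulo "same stabilization".
-- There G_e consists of the x with x ⊕ e = x that divide e.  A configuration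
-- divides e iff each of its grains does, and deg(v) grains at v equal the row of
-- out-neighbours of v.  Hence grains in C = cl(supp e) divide e, and then, by
-- induction along the acyclic set A(e), so do grains in A(e).  Conversely, a
-- grain at v dividing e passes this property on to every vertex reachable from
-- v, and a grain in a cyclic component leaves a grain there forever, so every
-- cyclic component reachable from v meets supp(e).  Finally, if x ⊕ e = x then
-- x + e topples only inside C, so the restriction g of x to C satisfies
-- g ⊕ e = g, which makes g recurrent in ι(supp e) because every configuration
-- on C divides e with a cofactor on C.
module Submission where

open import Algebra.Bundles using (CommutativeMonoid)
open import Algebra.Definitions using (Congruent₂)
open import Data.Bool using (if_then_else_)
open import Data.Fin using (Fin; zero; suc; _≟_)
open import Data.Fin.Induction using (spo-wellFounded)
open import Data.Fin.Properties using (any?; all?; ¬∀⟶∃¬)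
open import Data.List using (List; []; _∷_; allFin)
open import Data.List.Membership.Propositional using (_∈_)
open import Data.List.Membership.Propositional.Properties using (∈-allFin)
open import Data.List.Relation.Unary.Any using (here; there)
open import Data.Nat using (ℕ; zero; suc; pred; _+_; _*_; _∸_; _≤_; _<_; z≤n; z<s; _<?_; NonZero; >-nonZero)
open import Data.Nat.Induction using (<-wellFounded)
open import Data.Nat.Properties hiding (_≟_)
import Algebra.Properties.CommutativeSemigroup
import Algebra.Properties.CommutativeSemigroup +-commutativeSemigroup as ℕ+
import Algebra.Properties.CommutativeSemigroup *-commutativeSemigroup as ℕ*
open import Data.Product using (∃; _×_; _,_; proj₁; proj₂)
open import Data.Sum using (_⊎_; inj₁; inj₂; [_,_]′)
open import Data.Unit using (tt)
open import Data.Vec using ([]; _∷_; lookup; tabulate; sum)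
open import Data.Vec.Functional using (updateAt)
open import Data.Vec.Functional.Properties using (updateAt-updates; updateAt-minimal)
open import Data.Vec.Properties using (lookup∘tabulate; tabulate∘lookup; tabulate-cong; lookup-zipWith; lookup-replicate; zipWith-comm; zipWith-assoc; zipWith-identityˡ)
open import Defs
open import Function using (_∘_; id)
open import Function.Bundles using (_⇔_; mk⇔)
open import Induction.WellFounded using (Acc; acc)
open import Relation.Binary.Definitions using (Trans; Decidable)
open import Relation.Binary.PropositionalEquality
import Relation.Binary.Reasoning.Setoid
open import Relation.Binary.Structures using (IsStrictPartialOrder)
open import Relation.Nullary using (¬_; Dec; yes; no; contradiction)
open import Relation.Nullary.Decidable using (⌊_⌋; ¬?; _⊎-dec_; _×-dec_; map′)

-- Finite sums of natural numbers.

∑ : ∀ {n} → (Fin n → ℕ) → ℕ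
∑ f = sum (tabulate f)

∑-cong : ∀ {n} {f g : Fin n → ℕ} → f ≗ g → ∑ f ≡ ∑ g
∑-cong = cong sum ∘ tabulate-cong

∑-distrib-+ : ∀ {n} (f g : Fin n → ℕ) → ∑ (λ i → f i + g i) ≡ ∑ f + ∑ g
∑-distrib-+ {zero}  f g = refl
∑-distrib-+ {suc n} f g = trans (cong (f zero + g zero +_) (∑-distrib-+ (f ∘ suc) (g ∘ suc)))
                                (ℕ+.interchange (f zero) (g zero) _ _)

*-distribˡ-∑ : ∀ {n} k (f : Fin n → ℕ) → k * ∑ f ≡ ∑ (λ i → k * f i)
*-distribˡ-∑ {zero}  k f = *-zeroʳ k
*-distribˡ-∑ {suc n} k f = trans (*-distribˡ-+ k (f zero) _) (cong (k * f zero +_) (*-distribˡ-∑ k (f ∘ suc)))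

-- The two exceptional terms sit on opposite sides, so that no truncated subtraction is needed.
∑-agree-off : ∀ {n} (v : Fin n) {f g : Fin n → ℕ} → (∀ w → w ≢ v → f w ≡ g w) →
              ∑ f + g v ≡ ∑ g + f v
∑-agree-off zero {f} {g} f≡g = begin
  f zero + ∑ (f ∘ suc) + g zero  ≡⟨ ℕ+.xy∙z≈zy∙x (f zero) _ _ ⟩
  g zero + ∑ (f ∘ suc) + f zero  ≡⟨ cong (λ s → g zero + s + f zero) (∑-cong λ i → f≡g (suc i) λ ()) ⟩
  g zero + ∑ (g ∘ suc) + f zero  ∎
  where open ≡-Reasoning
∑-agree-off (suc v) {f} {g} f≡g = begin
  f zero + ∑ (f ∘ suc) + g (suc v)    ≡⟨ +-assoc (f zero) _ _ ⟩
  f zero + (∑ (f ∘ suc) + g (suc v))  ≡⟨ cong₂ _+_ (f≡g zero λ ()) (∑-agree-off v λ w w≢v → f≡g (suc w) λ { refl → w≢v refl }) ⟩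
  g zero + (∑ (g ∘ suc) + f (suc v))  ≡⟨ +-assoc (g zero) _ _ ⟨
  g zero + ∑ (g ∘ suc) + f (suc v)    ∎
  where open ≡-Reasoning

-- Configurations, single grains, supports and restrictions.

≗⇒≡ : ∀ {n} {a b : Config n} → lookup a ≗ lookup b → a ≡ b
≗⇒≡ {a = a} {b} p = trans (sym (tabulate∘lookup a)) (trans (tabulate-cong p) (tabulate∘lookup b))

lookup-⊞ : ∀ {n} (a b : Config n) v → lookup (a ⊞ b) v ≡ lookup a v + lookup b v
lookup-⊞ a b v = lookup-zipWith _+_ v a b

⊞-comm : ∀ {n} (a b : Config n) → a ⊞ b ≡ b ⊞ a
⊞-comm = zipWith-comm +-comm

⊞-assoc : ∀ {n} (a b c : Config n) → (a ⊞ b) ⊞ c ≡ a ⊞ (b ⊞ c)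
⊞-assoc = zipWith-assoc +-assoc

⊞-identityˡ : ∀ {n} (a : Config n) → zeroC n ⊞ a ≡ a
⊞-identityˡ = zipWith-identityˡ +-identityˡ

δ : ∀ {n} → Fin n → Config n
δ zero    = 1 ∷ zeroC _
δ (suc v) = 0 ∷ δ v

lookup-δ-self : ∀ {n} (v : Fin n) → lookup (δ v) v ≡ 1
lookup-δ-self zero    = refl
lookup-δ-self (suc v) = lookup-δ-self v

lookup-δ-other : ∀ {n} {v w : Fin n} → w ≢ v → lookup (δ v) w ≡ 0
lookup-δ-other {v = zero}  {zero}  w≢v = contradiction refl w≢v
lookup-δ-other {v = zero}  {suc w} w≢v = lookup-replicate w 0
lookup-δ-other {v = suc v} {zero}  w≢v = refl
lookup-δ-other {v = suc v} {suc w} w≢v = lookup-δ-other (w≢v ∘ cong suc)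

remove-grain : ∀ {n} (c : Config n) v → 0 < lookup c v → ∃ λ d → c ≡ δ v ⊞ d
remove-grain (suc k ∷ c) zero    _ = k ∷ c , cong (suc k ∷_) (sym (⊞-identityˡ c))
remove-grain (k ∷ c)     (suc v) p with remove-grain c v p
... | d , eq = k ∷ d , cong (k ∷_) eq

-- Peels single grains off the head; once the head is empty, the recursion enters the tail with `0`
-- prefixed to the predicate. Only occupied vertices are asked for a proof, so support conditions
-- can be used there.
⊞-induction : ∀ {n} (Q : Config n → Set) → Q (zeroC n) → (∀ {a b} → Q a → Q b → Q (a ⊞ b)) →
              ∀ c → (∀ v → 0 < lookup c v → Q (δ v)) → Q c
⊞-induction Q Q0 Q⊞ []      Qδ = Q0
⊞-induction Q Q0 Q⊞ (zero ∷ c) Qδ = ⊞-induction (Q ∘ (0 ∷_)) Q0 Q⊞ c (Qδ ∘ suc)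
⊞-induction Q Q0 Q⊞ (suc k ∷ c) Qδ =
  subst (Q ∘ (suc k ∷_)) (⊞-identityˡ c)
    (Q⊞ (Qδ zero z<s) (⊞-induction Q Q0 Q⊞ (k ∷ c) λ { zero _ → Qδ zero z<s ; (suc v) → Qδ (suc v) }))

_·_ : ∀ {n} → ℕ → Config n → Config n
zero  · c = zeroC _
suc k · c = c ⊞ (k · c)

lookup-· : ∀ {n} k (c : Config n) v → lookup (k · c) v ≡ k * lookup c v
lookup-· zero    c v = lookup-replicate v 0
lookup-· (suc k) c v = trans (lookup-⊞ c (k · c) v) (cong (lookup c v +_) (lookup-· k c v))

-- Contrapositive of `Supported`; this form yields membership in `U` without deciding it.
Positive⊆ : ∀ {n} → Config n → Pred n → Set
Positive⊆ c U = ∀ v → 0 < lookup c v → U v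

Positive⊆-⊞ : ∀ {n} {U : Pred n} a b → Positive⊆ a U → Positive⊆ b U → Positive⊆ (a ⊞ b) U
Positive⊆-⊞ a b a⊆ b⊆ v p with lookup a v in eq
... | suc _ = a⊆ v (subst (0 <_) (sym eq) z<s)
... | zero  = b⊆ v (subst (0 <_) (trans (lookup-⊞ a b v) (cong (_+ lookup b v) eq)) p)

Positive⊆-⊞⁻ʳ : ∀ {n} {U : Pred n} a b → Positive⊆ (a ⊞ b) U → Positive⊆ b U
Positive⊆-⊞⁻ʳ a b ab⊆ v p =
  ab⊆ v (subst (0 <_) (sym (lookup-⊞ a b v)) (<-≤-trans p (m≤n+m _ (lookup a v))))

if-yes : ∀ {P : Set} {x y : ℕ} (p? : Dec P) → P → (if ⌊ p? ⌋ then x else y) ≡ x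
if-yes (yes _) p = refl
if-yes (no ¬p) p = contradiction p ¬p

if-no : ∀ {P : Set} {x y : ℕ} (p? : Dec P) → ¬ P → (if ⌊ p? ⌋ then x else y) ≡ y
if-no (yes p) ¬p = contradiction p ¬p
if-no (no _)  ¬p = refl

module _ {n : ℕ} {U : Pred n} (U? : ∀ v → Dec (U v)) where

  restrict : Config n → Config n
  restrict x = tabulate λ v → if ⌊ U? v ⌋ then lookup x v else 0

  lookup-restrict-∈ : ∀ x {v} → U v → lookup (restrict x) v ≡ lookup x v
  lookup-restrict-∈ x {v} Uv = trans (lookup∘tabulate _ v) (if-yes (U? v) Uv)

  lookup-restrict-∉ : ∀ x {v} → ¬ U v → lookup (restrict x) v ≡ 0
  lookup-restrict-∉ x {v} ¬Uv = trans (lookup∘tabulate _ v) (if-no (U? v) ¬Uv)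

  restrict-≤ : ∀ x v → lookup (restrict x) v ≤ lookup x v
  restrict-≤ x v with U? v
  ... | yes Uv = ≤-reflexive (lookup-restrict-∈ x Uv)
  ... | no ¬Uv = subst (_≤ lookup x v) (sym (lookup-restrict-∉ x ¬Uv)) z≤n

  restrict-Positive⊆ : ∀ x → Positive⊆ (restrict x) U
  restrict-Positive⊆ x v p with U? v
  ... | yes Uv = Uv
  ... | no ¬Uv = contradiction (subst (0 <_) (lookup-restrict-∉ x ¬Uv) p) λ ()

restrict-complement : ∀ {n} {U : Pred n} (U? : ∀ v → Dec (U v)) x →
                      restrict U? x ⊞ restrict (¬? ∘ U?) x ≡ x
restrict-complement {U = U} U? x = ≗⇒≡ λ v → trans (lookup-⊞ (restrict U? x) _ v) (pointwise v)
  where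
  pointwise : ∀ v → lookup (restrict U? x) v + lookup (restrict (¬? ∘ U?) x) v ≡ lookup x v
  pointwise v with U? v
  ... | yes Uv = trans (cong₂ _+_ (lookup-restrict-∈ U? x Uv) (lookup-restrict-∉ (¬? ∘ U?) x λ ¬Uv → ¬Uv Uv)) (+-identityʳ _)
  ... | no ¬Uv = cong₂ _+_ (lookup-restrict-∉ U? x ¬Uv) (lookup-restrict-∈ (¬? ∘ U?) x ¬Uv)

⊞-cancelʳ : ∀ {n} (a b c : Config n) → a ⊞ c ≡ b ⊞ c → a ≡ b
⊞-cancelʳ a b c eq = ≗⇒≡ λ v → +-cancelʳ-≡ (lookup c v) _ _
  (trans (sym (lookup-⊞ a c v)) (trans (cong (λ d → lookup d v) eq) (lookup-⊞ b c v)))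

-- Reachability and strongly connected components.

module _ {n : ℕ} (G : Graph n) where

  Reach-trans : Trans (Reach G) (Reach G) (Reach G)
  Reach-trans here       q = q
  Reach-trans (step x p) q = step x (Reach-trans p q)

  -- Floyd–Warshall: paths whose interior vertices all lie in the given list.
  ReachVia : List (Fin n) → Fin n → Fin n → Set
  ReachVia []       i j = i ≡ j ⊎ Edge G i j
  ReachVia (v ∷ vs) i j = ReachVia vs i j ⊎ (ReachVia vs i v × ReachVia vs v j)

  reachVia? : ∀ vs → Decidable (ReachVia vs)
  reachVia? []       i j = (i ≟ j) ⊎-dec (0 <? adj G i j)
  reachVia? (v ∷ vs) i j = reachVia? vs i j ⊎-dec (reachVia? vs i v ×-dec reachVia? vs v j)

  ReachVia⇒Reach : ∀ vs {i j} → ReachVia vs i j → Reach G i j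
  ReachVia⇒Reach []       (inj₁ refl)    = here
  ReachVia⇒Reach []       (inj₂ e)       = step e here
  ReachVia⇒Reach (v ∷ vs) (inj₁ p)       = ReachVia⇒Reach vs p
  ReachVia⇒Reach (v ∷ vs) (inj₂ (p , q)) = Reach-trans (ReachVia⇒Reach vs p) (ReachVia⇒Reach vs q)

  ReachVia-refl : ∀ vs {i} → ReachVia vs i i
  ReachVia-refl []       = inj₁ refl
  ReachVia-refl (_ ∷ vs) = inj₁ (ReachVia-refl vs)

  Edge⇒ReachVia : ∀ vs {i j} → Edge G i j → ReachVia vs i j
  Edge⇒ReachVia []       e = inj₂ e
  Edge⇒ReachVia (_ ∷ vs) e = inj₁ (Edge⇒ReachVia vs e)

  -- If `m` is the vertex just added, both paths are cut at `m`. If both pass through another added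
  -- vertex `v`, the loop from `v` through `m` back to `v` is discarded.
  ReachVia-trans : ∀ vs {i m j} → m ∈ vs → ReachVia vs i m → ReachVia vs m j → ReachVia vs i j
  ReachVia-trans (v ∷ vs) (here refl) p q = inj₂ ([ id , proj₁ ]′ p , [ id , proj₂ ]′ q)
  ReachVia-trans (v ∷ vs) (there m) (inj₁ p)       (inj₁ q)       = inj₁ (ReachVia-trans vs m p q)
  ReachVia-trans (v ∷ vs) (there m) (inj₁ p)       (inj₂ (q , r)) = inj₂ (ReachVia-trans vs m p q , r)
  ReachVia-trans (v ∷ vs) (there m) (inj₂ (o , p)) (inj₁ q)       = inj₂ (o , ReachVia-trans vs m p q)
  ReachVia-trans (v ∷ vs) (there m) (inj₂ (o , p)) (inj₂ (q , r)) = inj₂ (o , r)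

  Reach⇒ReachVia : ∀ {i j} → Reach G i j → ReachVia (allFin n) i j
  Reach⇒ReachVia here       = ReachVia-refl (allFin n)
  Reach⇒ReachVia (step e p) =
    ReachVia-trans (allFin n) (∈-allFin _) (Edge⇒ReachVia (allFin n) e) (Reach⇒ReachVia p)

  reach? : Decidable (Reach G)
  reach? i j = map′ (ReachVia⇒Reach (allFin n)) Reach⇒ReachVia (reachVia? (allFin n) i j)

  cl-supp? : ∀ c v → Dec (cl G (supp G c) v)
  cl-supp? c v = any? λ w → (0 <? lookup c w) ×-dec reach? w v

  -- Being strictly downstream: the negation removes pairs in one component. On finitely many
  -- vertices this strict order is well-founded, which supports the induction along `A G e`.
  _⊏_ : Fin n → Fin n → Set
  u ⊏ v = Reach G v u × ¬ Reach G u v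

  ⊏-isStrictPartialOrder : IsStrictPartialOrder _≡_ _⊏_
  ⊏-isStrictPartialOrder = record
    { isEquivalence = isEquivalence
    ; irrefl = λ { refl (_ , ¬refl) → ¬refl here }
    ; trans = λ { (j⇝i , ¬i⇝j) (k⇝j , _) → Reach-trans k⇝j j⇝i , λ i⇝k → ¬i⇝j (Reach-trans i⇝k k⇝j) }
    ; <-resp-≈ = (λ { refl p → p }) , (λ { refl p → p }) }

  -- A path from `w` to the cycle vertex `t` starts with an edge that stays in the component, since
  -- `t` leads back; if the path is trivial, the first edge of the cycle serves.
  successor-in-SCC : ∀ {u w} → CyclicSCCof G u → SameSCC G u w → ∃ λ w′ → Edge G w w′ × SameSCC G u w′
  successor-in-SCC (t , (u⇝t , t⇝u) , (t′ , t→t′ , t′⇝t)) (u⇝w , w⇝u) with Reach-trans w⇝u u⇝t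
  ... | here           = t′ , t→t′ , Reach-trans u⇝t (step t→t′ here) , Reach-trans t′⇝t t⇝u
  ... | step w→w′ w′⇝t = _ , w→w′ , Reach-trans u⇝w (step w→w′ here) , Reach-trans w′⇝t t⇝u

  Closed : Pred n → Set
  Closed U = ∀ {v w} → U v → Edge G v w → U w

  cl-closed : ∀ W → Closed (cl G W)
  cl-closed W (w , Ww , p) e = w , Ww , Reach-trans p (step e here)

  -- Topplings, their commutation, and uniqueness of stabilizations.

  lookup-topple-self : ∀ v c → lookup (topple G v c) v ≡ lookup c v ∸ deg G v + adj G v v
  lookup-topple-self v c = trans (lookup∘tabulate _ v) (cong (_+ adj G v v) (if-yes (v ≟ v) refl))

  lookup-topple-other : ∀ {v w} c → w ≢ v → lookup (topple G v c) w ≡ lookup c w + adj G v w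
  lookup-topple-other {v} {w} c w≢v = trans (lookup∘tabulate _ w) (cong (_+ adj G v w) (if-no (w ≟ v) w≢v))

  -- Legality lets the truncated subtraction commute with adding `x`.
  topple-⊞ : ∀ {v} c x → deg G v ≤ lookup c v → topple G v (c ⊞ x) ≡ topple G v c ⊞ x
  topple-⊞ {v} c x deg≤ = ≗⇒≡ pointwise
    where
    open ≡-Reasoning
    pointwise : ∀ w → lookup (topple G v (c ⊞ x)) w ≡ lookup (topple G v c ⊞ x) w
    pointwise w with w ≟ v
    ... | yes refl = begin
      lookup (topple G v (c ⊞ x)) v                        ≡⟨ lookup-topple-self v (c ⊞ x) ⟩
      lookup (c ⊞ x) v ∸ deg G v + adj G v v               ≡⟨ cong (λ k → k ∸ deg G v + adj G v v) (lookup-⊞ c x v) ⟩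
      (lookup c v + lookup x v) ∸ deg G v + adj G v v      ≡⟨ cong (_+ adj G v v) (+-∸-comm (lookup x v) deg≤) ⟩
      (lookup c v ∸ deg G v) + lookup x v + adj G v v      ≡⟨ ℕ+.xy∙z≈xz∙y (lookup c v ∸ deg G v) _ _ ⟩
      (lookup c v ∸ deg G v) + adj G v v + lookup x v      ≡⟨ cong (_+ lookup x v) (lookup-topple-self v c) ⟨
      lookup (topple G v c) v + lookup x v                 ≡⟨ lookup-⊞ (topple G v c) x v ⟨
      lookup (topple G v c ⊞ x) v                          ∎
    ... | no w≢v = begin
      lookup (topple G v (c ⊞ x)) w              ≡⟨ lookup-topple-other (c ⊞ x) w≢v ⟩
      lookup (c ⊞ x) w + adj G v w               ≡⟨ cong (_+ adj G v w) (lookup-⊞ c x w) ⟩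
      lookup c w + lookup x w + adj G v w        ≡⟨ ℕ+.xy∙z≈xz∙y (lookup c w) _ _ ⟩
      lookup c w + adj G v w + lookup x w        ≡⟨ cong (_+ lookup x w) (lookup-topple-other c w≢v) ⟨
      lookup (topple G v c) w + lookup x w       ≡⟨ lookup-⊞ (topple G v c) x w ⟨
      lookup (topple G v c ⊞ x) w                ∎

  -- At `v` the toppling of `w` only adds grains, so legality at `v` exchanges the two.
  topple-comm-self : ∀ {v w} c → v ≢ w → deg G v ≤ lookup c v →
                     lookup (topple G w (topple G v c)) v ≡ lookup (topple G v (topple G w c)) v
  topple-comm-self {v} {w} c v≢w deg≤ = begin
    lookup (topple G w (topple G v c)) v             ≡⟨ lookup-topple-other (topple G v c) v≢w ⟩
    lookup (topple G v c) v + adj G w v              ≡⟨ cong (_+ adj G w v) (lookup-topple-self v c) ⟩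
    lookup c v ∸ deg G v + adj G v v + adj G w v     ≡⟨ ℕ+.xy∙z≈xz∙y (lookup c v ∸ deg G v) _ _ ⟩
    lookup c v ∸ deg G v + adj G w v + adj G v v     ≡⟨ cong (_+ adj G v v) (+-∸-comm (adj G w v) deg≤) ⟨
    (lookup c v + adj G w v) ∸ deg G v + adj G v v   ≡⟨ cong (λ k → k ∸ deg G v + adj G v v) (lookup-topple-other c v≢w) ⟨
    lookup (topple G w c) v ∸ deg G v + adj G v v    ≡⟨ lookup-topple-self v (topple G w c) ⟨
    lookup (topple G v (topple G w c)) v             ∎
    where open ≡-Reasoning

  topple-comm : ∀ {v w} c → v ≢ w → deg G v ≤ lookup c v → deg G w ≤ lookup c w →
                topple G w (topple G v c) ≡ topple G v (topple G w c)
  topple-comm {v} {w} c v≢w deg≤v deg≤w = ≗⇒≡ pointwise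
    where
    open ≡-Reasoning
    pointwise : ∀ u → lookup (topple G w (topple G v c)) u ≡ lookup (topple G v (topple G w c)) u
    pointwise u with u ≟ v | u ≟ w
    ... | yes refl | _        = topple-comm-self c v≢w deg≤v
    ... | no _     | yes refl = sym (topple-comm-self c (v≢w ∘ sym) deg≤w)
    ... | no u≢v   | no u≢w   = begin
      lookup (topple G w (topple G v c)) u    ≡⟨ lookup-topple-other (topple G v c) u≢w ⟩
      lookup (topple G v c) u + adj G w u     ≡⟨ cong (_+ adj G w u) (lookup-topple-other c u≢v) ⟩
      lookup c u + adj G v u + adj G w u      ≡⟨ ℕ+.xy∙z≈xz∙y (lookup c u) _ _ ⟩
      lookup c u + adj G w u + adj G v u      ≡⟨ cong (_+ adj G v u) (lookup-topple-other c u≢w) ⟨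
      lookup (topple G w c) u + adj G v u     ≡⟨ lookup-topple-other (topple G w c) u≢v ⟨
      lookup (topple G v (topple G w c)) u    ∎

  topple-other-≤ : ∀ {v w} c → w ≢ v → lookup c w ≤ lookup (topple G v c) w
  topple-other-≤ {v} {w} c w≢v = subst (lookup c w ≤_) (sym (lookup-topple-other c w≢v)) (m≤m+n _ _)

  topple-adj-≤ : ∀ v w c → adj G v w ≤ lookup (topple G v c) w
  topple-adj-≤ v w c = subst (adj G v w ≤_) (sym (lookup∘tabulate _ w)) (m≤n+m _ _)

  -- The final configuration is stable at `v`, so the sequence must fire `v` at some point;
  -- commutation moves that firing to the front.
  Stab-topple : ∀ {U c s} v → U v → deg G v ≤ lookup c v → Stab G U c s → Stab G U (topple G v c) s
  Stab-topple v Uv deg≤ (done stable) = contradiction (stable v Uv) (≤⇒≯ deg≤)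
  Stab-topple {U} {c} {s} v Uv deg≤ (fire w Uw deg≤w p) with v ≟ w
  ... | yes refl = p
  ... | no v≢w   = fire w Uw (≤-trans deg≤w (topple-other-≤ c (v≢w ∘ sym)))
    (subst (λ d → Stab G U d s) (sym (topple-comm c v≢w deg≤ deg≤w))
      (Stab-topple v Uv (≤-trans deg≤ (topple-other-≤ c v≢w)) p))

  Stab-unique : ∀ {U c s t} → Stab G U c s → Stab G U c t → s ≡ t
  Stab-unique (done s-stable)    (done _)           = refl
  Stab-unique (done s-stable)    (fire v Uv deg≤ _) = contradiction (s-stable v Uv) (≤⇒≯ deg≤)
  Stab-unique (fire v Uv deg≤ p) q                  = Stab-unique p (Stab-topple v Uv deg≤ q)

  Stab-stable : ∀ {U c s} → Stab G U c s → StableOn G U s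
  Stab-stable (done stable)  = stable
  Stab-stable (fire _ _ _ p) = Stab-stable p

  -- Extra grains keep topplings legal, so those that stabilize `c` can be carried out first.
  Stab-⊞ : ∀ {c s t} x → Stab G (All G) c s → Stab G (All G) (s ⊞ x) t → Stab G (All G) (c ⊞ x) t
  Stab-⊞ x (done _) q = q
  Stab-⊞ {c} {t = t} x (fire v _ deg≤ p) q =
    fire v tt (≤-trans deg≤ (subst (lookup c v ≤_) (sym (lookup-⊞ c x v)) (m≤m+n _ _)))
      (subst (λ d → Stab G (All G) d t) (sym (topple-⊞ c x deg≤)) (Stab-⊞ x p q))

  Stab-extend : ∀ {U c s} → StableOn G (All G) s → Stab G U c s → Stab G (All G) c s
  Stab-extend stable (done _)          = done stable
  Stab-extend stable (fire v _ deg≤ p) = fire v tt deg≤ (Stab-extend stable p)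

  -- A grain inside a cyclic strongly connected component can only leave its
  -- vertex by a toppling, which puts another grain into the component.
  module _ {u} (cyclic : CyclicSCCof G u) where

    Inhabited : Config n → Set
    Inhabited c = ∃ λ w → SameSCC G u w × supp G c w

    topple-Inhabited : ∀ v c → Inhabited c → Inhabited (topple G v c)
    topple-Inhabited v c (w , scc , p) with w ≟ v
    ... | no w≢v = w , scc , <-≤-trans p (topple-other-≤ c w≢v)
    ... | yes refl with successor-in-SCC cyclic scc
    ...   | w′ , w→w′ , scc′ = w′ , scc′ , <-≤-trans w→w′ (topple-adj-≤ w w′ c)

    Stab-Inhabited : ∀ {c s} → Stab G (All G) c s → Inhabited c → Inhabited s
    Stab-Inhabited (done _)           = id
    Stab-Inhabited {c} (fire v _ _ p) = Stab-Inhabited p ∘ topple-Inhabited v c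

  -- Superharmonic weights and their decrease under toppling.

  out : (Fin n → ℕ) → Fin n → ℕ
  out φ v = ∑ λ w → adj G v w * φ w

  -- `deg G v * φ v` is the weight that toppling `v` removes and `out φ v` the weight that it puts
  -- back, so no toppling raises the total weight.
  Superharmonic : (Fin n → ℕ) → Set
  Superharmonic φ = ∀ v → out φ v ≤ deg G v * φ v

  StrictAt : (Fin n → ℕ) → Fin n → Set
  StrictAt φ v = out φ v < deg G v * φ v

  out-+ : ∀ φ ψ v → out (λ w → φ w + ψ w) v ≡ out φ v + out ψ v
  out-+ φ ψ v = trans (∑-cong λ w → *-distribˡ-+ (adj G v w) (φ w) (ψ w))
                        (∑-distrib-+ (λ w → adj G v w * φ w) (λ w → adj G v w * ψ w))

  out-* : ∀ k φ v → out (λ w → k * φ w) v ≡ k * out φ v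
  out-* k φ v = trans (∑-cong λ w → ℕ*.x∙yz≈y∙xz (adj G v w) k (φ w)) (sym (*-distribˡ-∑ k λ w → adj G v w * φ w))

  -- Strictness at u leaves room to lower a large multiple of φ by one at u,
  -- which creates strictness at every predecessor of u.
  module _ {φ} (super : Superharmonic φ) {u} (strict-u : StrictAt φ u) {K} (deg<K : deg G u < K) where

    lowered : Fin n → ℕ
    lowered = updateAt (λ w → K * φ w) u pred

    suc-lowered : suc (lowered u) ≡ K * φ u
    suc-lowered = trans (cong suc (updateAt-updates u _)) (suc-pred (K * φ u) ⦃ nonZero ⦄)
      where
      nonZero : NonZero (K * φ u)
      -- Strictness at `u` makes `deg G u * φ u` positive, so `pred` really subtracts one.
      nonZero = >-nonZero (<-≤-trans (≤-<-trans z≤n strict-u) (*-monoˡ-≤ (φ u) (<⇒≤ deg<K)))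

    out-lowered : ∀ v → out lowered v + adj G v u ≡ K * out φ v
    out-lowered v = +-cancelʳ-≡ (a * lowered u) _ _ (begin
      out lowered v + a + a * lowered u             ≡⟨ +-assoc (out lowered v) a _ ⟩
      out lowered v + (a + a * lowered u)           ≡⟨ cong (out lowered v +_) (*-suc a (lowered u)) ⟨
      out lowered v + a * suc (lowered u)           ≡⟨ cong (λ k → out lowered v + a * k) suc-lowered ⟩
      out lowered v + a * (K * φ u)                 ≡⟨ ∑-agree-off u (λ w w≢u → cong (adj G v w *_) (updateAt-minimal w u _ w≢u)) ⟩
      out (λ w → K * φ w) v + a * lowered u         ≡⟨ cong (_+ a * lowered u) (out-* K φ v) ⟩
      K * out φ v + a * lowered u                   ∎)
      where
      open ≡-Reasoning
      a = adj G v u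

    -- Every edge from `v` to `u` saves one unit on the left, while the value at `v` is only scaled;
    -- this surplus is the strictness at predecessors.
    lowered-≤ : ∀ {v} → v ≢ u → out lowered v + adj G v u ≤ deg G v * lowered v
    lowered-≤ {v} v≢u = begin
      out lowered v + adj G v u   ≡⟨ out-lowered v ⟩
      K * out φ v                 ≤⟨ *-monoʳ-≤ K (super v) ⟩
      K * (deg G v * φ v)         ≡⟨ ℕ*.x∙yz≈y∙xz K (deg G v) (φ v) ⟩
      deg G v * (K * φ v)         ≡⟨ cong (deg G v *_) (updateAt-minimal v u _ v≢u) ⟨
      deg G v * lowered v         ∎
      where
      open ≤-Reasoning

    -- Lowering at `u` costs `deg G u` on the right, but scaling the strict inequality by `K` gains
    -- `K`, which is larger.
    lowered-strict-self : StrictAt lowered u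
    lowered-strict-self = +-cancelʳ-≤ d (suc (out lowered u)) (d * lowered u) (begin
      suc (out lowered u) + d                    ≡⟨ +-suc (out lowered u) d ⟨
      out lowered u + suc d                      ≤⟨ +-mono-≤ (m≤m+n (out lowered u) (adj G u u)) deg<K ⟩
      out lowered u + adj G u u + K              ≡⟨ cong (_+ K) (out-lowered u) ⟩
      K * out φ u + K                            ≡⟨ trans (*-suc K (out φ u)) (+-comm K (K * out φ u)) ⟨
      K * suc (out φ u)                          ≤⟨ *-monoʳ-≤ K strict-u ⟩
      K * (d * φ u)                              ≡⟨ ℕ*.x∙yz≈y∙xz K d (φ u) ⟩
      d * (K * φ u)                              ≡⟨ cong (d *_) suc-lowered ⟨
      d * suc (lowered u)                        ≡⟨ trans (*-suc d (lowered u)) (+-comm d (d * lowered u)) ⟩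
      d * lowered u + d                          ∎)
      where
      open ≤-Reasoning
      d = deg G u

    lowered-superharmonic : Superharmonic lowered
    lowered-superharmonic v with v ≟ u
    ... | yes refl = <⇒≤ lowered-strict-self
    ... | no v≢u   = ≤-trans (m≤m+n _ _) (lowered-≤ v≢u)

    lowered-strict : ∀ {v} → Edge G v u → StrictAt lowered v
    lowered-strict {v} edge with v ≟ u
    ... | yes refl = lowered-strict-self
    ... | no v≢u   = <-≤-trans (m<m+n _ edge) (lowered-≤ v≢u)

  -- Induction on the path to the sink: the constant one is strict where an edge enters the sink,
  -- and lowering carries strictness back along each edge.
  superharmonic-strict-at : ∀ {v} → ReachSink G v → ∃ λ φ → Superharmonic φ × StrictAt φ v
  superharmonic-strict-at (direct 0<sink) =
    (λ _ → 1) , (λ v → subst₂ _≤_ (sym (out-1 v)) (sym (*-identityʳ _)) (m≤m+n _ _))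
              , subst₂ _<_ (sym (out-1 _)) (sym (*-identityʳ _)) (m<m+n _ 0<sink)
    where
    out-1 : ∀ v → out (λ _ → 1) v ≡ ∑ (adj G v)
    out-1 v = ∑-cong λ w → *-identityʳ (adj G v w)
  superharmonic-strict-at (via edge p) with superharmonic-strict-at p
  -- `≤-refl` chooses `K` to be `suc (deg G u)`.
  ... | φ , super , strict = lowered super strict ≤-refl , lowered-superharmonic super strict ≤-refl , lowered-strict super strict ≤-refl edge

  -- A sum of superharmonic weights is strict wherever one summand is.
  superharmonic-strict-on : (∀ v → ReachSink G v) → ∀ vs →
                            ∃ λ φ → Superharmonic φ × (∀ {v} → v ∈ vs → StrictAt φ v)
  superharmonic-strict-on toSink []       =
    (λ _ → 0) , (λ v → ≤-reflexive (trans (out-* 0 (λ _ → 0) v) (sym (*-zeroʳ (deg G v))))) , λ ()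
  superharmonic-strict-on toSink (v ∷ vs)
    with superharmonic-strict-at (toSink v) | superharmonic-strict-on toSink vs
  ... | φ , φ-super , φ-strict | ψ , ψ-super , ψ-strict =
    (λ w → φ w + ψ w) , (λ w → combine w (+-mono-≤ (φ-super w) (ψ-super w)))
                      , λ { (here refl) → combine′ v (+-mono-<-≤ φ-strict (ψ-super v))
                          ; (there w∈vs) → combine′ _ (+-mono-≤-< (φ-super _) (ψ-strict w∈vs)) }
    where
    combine : ∀ w → out φ w + out ψ w ≤ deg G w * φ w + deg G w * ψ w → out (λ w → φ w + ψ w) w ≤ deg G w * (φ w + ψ w)
    combine w = subst₂ _≤_ (sym (out-+ φ ψ w)) (sym (*-distribˡ-+ (deg G w) _ _))
    combine′ : ∀ w → out φ w + out ψ w < deg G w * φ w + deg G w * ψ w → StrictAt (λ w → φ w + ψ w) w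
    combine′ w = subst₂ _<_ (sym (out-+ φ ψ w)) (sym (*-distribˡ-+ (deg G w) _ _))

  weight : (Fin n → ℕ) → Config n → ℕ
  weight φ c = ∑ λ w → lookup c w * φ w

  weight-topple : ∀ φ {v} c → deg G v ≤ lookup c v →
                  weight φ (topple G v c) + deg G v * φ v ≡ weight φ c + out φ v
  -- `rest v` counts the grains kept at `v` before loops return any; its weight is added to both
  -- sides so that `∑-agree-off` applies.
  weight-topple φ {v} c deg≤ = +-cancelʳ-≡ (rest v * φ v) _ _ (begin
    weight φ (topple G v c) + d * φ v + rest v * φ v         ≡⟨ +-assoc (weight φ (topple G v c)) _ _ ⟩
    weight φ (topple G v c) + (d * φ v + rest v * φ v)       ≡⟨ cong₂ _+_ weight-split refill ⟩
    ∑ (λ w → rest w * φ w) + out φ v + lookup c v * φ v      ≡⟨ ℕ+.xy∙z≈xz∙y (∑ λ w → rest w * φ w) _ _ ⟩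
    ∑ (λ w → rest w * φ w) + lookup c v * φ v + out φ v      ≡⟨ cong (_+ out φ v) (∑-agree-off v λ w w≢v → cong (_* φ w) (if-no (w ≟ v) w≢v)) ⟩
    weight φ c + rest v * φ v + out φ v                      ≡⟨ ℕ+.xy∙z≈xz∙y (weight φ c) _ _ ⟩
    weight φ c + out φ v + rest v * φ v                      ∎)
    where
    open ≡-Reasoning
    d = deg G v
    rest : Fin n → ℕ
    rest w = if ⌊ w ≟ v ⌋ then lookup c w ∸ d else lookup c w
    weight-split : weight φ (topple G v c) ≡ ∑ (λ w → rest w * φ w) + out φ v
    weight-split = trans (∑-cong λ w → trans (cong (_* φ w) (lookup∘tabulate _ w)) (*-distribʳ-+ (φ w) (rest w) _))
                         (∑-distrib-+ (λ w → rest w * φ w) (λ w → adj G v w * φ w))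
    refill : d * φ v + rest v * φ v ≡ lookup c v * φ v
    refill = trans (sym (*-distribʳ-+ (φ v) d _))
      (cong (_* φ v) (trans (cong (d +_) (if-yes (v ≟ v) refl)) (m+[n∸m]≡n deg≤)))

  -- The path to the sink leaves `v` by some edge. Hence empty vertices are stable and unstable ones
  -- hold a grain.
  deg>0 : ∀ {v} → ReachSink G v → 0 < deg G v
  deg>0 {v} (direct 0<sink) = <-≤-trans 0<sink (m≤n+m _ _)
  deg>0 {v} (via {u = u} edge _) = ≤-trans (<-≤-trans edge (term≤∑ (adj G v) u)) (m≤m+n _ _)
    where
    term≤∑ : ∀ {m} (f : Fin m → ℕ) i → f i ≤ ∑ f
    term≤∑ f zero    = m≤m+n _ _
    term≤∑ f (suc i) = ≤-trans (term≤∑ (f ∘ suc) i) (m≤n+m _ _)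

  -- Existence of stabilizations and the monoid modulo equal stabilization.

  module Stabilization (toSink : ∀ v → ReachSink G v) where

    stabilize : ∀ c → ∃ (Stab G (All G) c)
    stabilize c = go c (<-wellFounded _)
      where
      φ = proj₁ (superharmonic-strict-on toSink (allFin n))
      strict : ∀ v → StrictAt φ v
      strict v = proj₂ (proj₂ (superharmonic-strict-on toSink (allFin n))) (∈-allFin v)
      decreases : ∀ {v} c → deg G v ≤ lookup c v → weight φ (topple G v c) < weight φ c
      decreases {v} c deg≤ = +-cancelʳ-< (out φ v) _ _
        (subst (weight φ (topple G v c) + out φ v <_) (weight-topple φ c deg≤) (+-monoʳ-< _ (strict v)))
      go : ∀ c → Acc _<_ (weight φ c) → ∃ (Stab G (All G) c)
      go c (acc rs) with all? (λ v → lookup c v <? deg G v)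
      ... | yes stable = c , done λ v _ → stable v
      ... | no ¬stable with ¬∀⟶∃¬ n _ (λ v → lookup c v <? deg G v) ¬stable
      ...   | v , ≮deg with go (topple G v c) (rs (decreases c (≮⇒≥ ≮deg)))
      ...     | s , p = s , fire v tt (≮⇒≥ ≮deg) p

    stab : Config n → Config n
    stab c = proj₁ (stabilize c)

    stab-Stab : ∀ c → Stab G (All G) c (stab c)
    stab-Stab c = proj₂ (stabilize c)

    infix 4 _≈_

    -- The record wrapper lets `a` and `b` be inferred from a proof.
    record _≈_ (a b : Config n) : Set where
      constructor mk≈
      field stab-≡ : stab a ≡ stab b
    open _≈_

    Stab⇒≈ : ∀ {c s} → Stab G (All G) c s → c ≈ s
    Stab⇒≈ {c} {s} p = mk≈ (trans (Stab-unique (stab-Stab c) p) (Stab-unique (done (Stab-stable p)) (stab-Stab s)))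

    ≈⇒Stab : ∀ {c s} → StableOn G (All G) s → c ≈ s → Stab G (All G) c s
    ≈⇒Stab {c} {s} stable (mk≈ eq) =
      subst (Stab G (All G) c) (trans eq (Stab-unique (stab-Stab s) (done stable))) (stab-Stab c)

    ≈-sym : ∀ {a b} → a ≈ b → b ≈ a
    ≈-sym (mk≈ eq) = mk≈ (sym eq)

    ≈-trans : ∀ {a b c} → a ≈ b → b ≈ c → a ≈ c
    ≈-trans (mk≈ eq) (mk≈ eq′) = mk≈ (trans eq eq′)

    -- Stabilizing before or after adding `x` gives the same result, so only `stab a` and `stab b`
    -- matter.
    ⊞-congʳ : ∀ {a b} x → a ≈ b → a ⊞ x ≈ b ⊞ x
    ⊞-congʳ {a} {b} x (mk≈ eq) = ≈-trans (normalize a) (≈-trans (mk≈ (cong (λ s → stab (s ⊞ x)) eq)) (≈-sym (normalize b)))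
      where
      normalize : ∀ c → c ⊞ x ≈ stab c ⊞ x
      normalize c = mk≈ (Stab-unique (stab-Stab (c ⊞ x)) (Stab-⊞ x (stab-Stab c) (stab-Stab (stab c ⊞ x))))

    ⊞-cong : Congruent₂ _≈_ _⊞_
    ⊞-cong {a} {b} {c} {d} a≈b c≈d =
      ≈-trans (⊞-congʳ c a≈b) (subst₂ _≈_ (⊞-comm c b) (⊞-comm d b) (⊞-congʳ b c≈d))

    ⊞-commutativeMonoid : CommutativeMonoid _ _
    ⊞-commutativeMonoid = record
      { Carrier = Config n ; _≈_ = _≈_ ; _∙_ = _⊞_ ; ε = zeroC n
      ; isCommutativeMonoid = isCommutativeMonoidˡ record
        { isSemigroup = record
          { isMagma = record
            { isEquivalence = record { refl = mk≈ refl ; sym = ≈-sym ; trans = ≈-trans }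
            ; ∙-cong = ⊞-cong }
          ; assoc = λ a b c → reflexive (⊞-assoc a b c) }
        ; identityˡ = λ a → reflexive (⊞-identityˡ a)
        ; comm = λ a b → reflexive (⊞-comm a b) } }
      where
      open import Algebra.Structures.Biased _≈_ using (isCommutativeMonoidˡ)
      reflexive : ∀ {a b} → a ≡ b → a ≈ b
      reflexive refl = mk≈ refl

    private
      module CM = CommutativeMonoid ⊞-commutativeMonoid
      module CS = Algebra.Properties.CommutativeSemigroup CM.commutativeSemigroup
      module ≈-Reasoning = Relation.Binary.Reasoning.Setoid CM.setoid

    topple-≈ : ∀ {v} c → deg G v ≤ lookup c v → c ≈ topple G v c
    topple-≈ {v} c deg≤ = mk≈ (Stab-unique (stab-Stab c) (fire v tt deg≤ (stab-Stab (topple G v c))))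

    stab-≈ : ∀ c → stab c ≈ c
    stab-≈ c = ≈-sym (Stab⇒≈ (stab-Stab c))

    stab-stable : ∀ c → StableOn G (All G) (stab c)
    stab-stable c = Stab-stable (stab-Stab c)

    -- The toppling relation as an equation of the monoid.

    row : Fin n → Config n
    row v = tabulate (adj G v)

    -- One toppling of a pile of exactly `deg G v` grains. Read in the two directions, it moves
    -- divisibility to successors and back to predecessors.
    deg·δ≈row : ∀ v → deg G v · δ v ≈ row v
    deg·δ≈row v = subst (deg G v · δ v ≈_) (≗⇒≡ pointwise) (topple-≈ (deg G v · δ v) (≤-reflexive (sym full)))
      where
      open ≡-Reasoning
      full : lookup (deg G v · δ v) v ≡ deg G v
      full = trans (lookup-· (deg G v) (δ v) v) (trans (cong (deg G v *_) (lookup-δ-self v)) (*-identityʳ _))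
      pointwise : ∀ w → lookup (topple G v (deg G v · δ v)) w ≡ lookup (row v) w
      pointwise w with w ≟ v
      ... | yes refl = begin
        lookup (topple G v (deg G v · δ v)) v                ≡⟨ lookup-topple-self v (deg G v · δ v) ⟩
        lookup (deg G v · δ v) v ∸ deg G v + adj G v v       ≡⟨ cong (λ k → k ∸ deg G v + adj G v v) full ⟩
        deg G v ∸ deg G v + adj G v v                        ≡⟨ cong (_+ adj G v v) (n∸n≡0 (deg G v)) ⟩
        adj G v v                                            ≡⟨ lookup∘tabulate (adj G v) v ⟨
        lookup (row v) v                                     ∎
      ... | no w≢v = begin
        lookup (topple G v (deg G v · δ v)) w     ≡⟨ lookup-topple-other (deg G v · δ v) w≢v ⟩
        lookup (deg G v · δ v) w + adj G v w      ≡⟨ cong (_+ adj G v w) (lookup-· (deg G v) (δ v) w) ⟩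
        deg G v * lookup (δ v) w + adj G v w      ≡⟨ cong (λ k → deg G v * k + adj G v w) (lookup-δ-other w≢v) ⟩
        deg G v * 0 + adj G v w                   ≡⟨ cong (_+ adj G v w) (*-zeroʳ (deg G v)) ⟩
        adj G v w                                 ≡⟨ lookup∘tabulate (adj G v) w ⟨
        lookup (row v) w                          ∎

    row⇒Edge : ∀ {v u} → 0 < lookup (row v) u → Edge G v u
    row⇒Edge {v} {u} = subst (0 <_) (lookup∘tabulate (adj G v) u)

    -- Dynamics on closed vertex sets compared with the whole graph.

    module _ {U : Pred n} (closed : Closed U) where

      unstable⇒∈ : ∀ c {v} → Positive⊆ c U → deg G v ≤ lookup c v → U v
      unstable⇒∈ c {v} c⊆ deg≤ = c⊆ v (<-≤-trans (deg>0 (toSink v)) deg≤)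

      topple-Positive⊆ : ∀ c {v} → Positive⊆ c U → deg G v ≤ lookup c v → Positive⊆ (topple G v c) U
      topple-Positive⊆ c {v} c⊆ deg≤ w p with w ≟ v
      ... | yes refl = unstable⇒∈ c c⊆ deg≤
      ... | no w≢v with lookup c w in eq
      ...   | suc _ = c⊆ w (subst (0 <_) (sym eq) z<s)
      ...   | zero  = closed (unstable⇒∈ c c⊆ deg≤)
                        (subst (0 <_) (trans (lookup-topple-other c w≢v) (cong (_+ adj G v w) eq)) p)

      Stab-Positive⊆ : ∀ {c s} → Positive⊆ c U → Stab G (All G) c s → Positive⊆ s U
      Stab-Positive⊆ c⊆ (done _)          = c⊆
      Stab-Positive⊆ {c} c⊆ (fire v _ deg≤ p) = Stab-Positive⊆ (topple-Positive⊆ c c⊆ deg≤) p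

      -- An unstable vertex holds a grain, hence lies in `U`, and closedness keeps the grains it
      -- sends inside `U`.
      Stab-restrict : ∀ {c s} → Positive⊆ c U → Stab G (All G) c s → Stab G U c s
      Stab-restrict c⊆ (done stable)     = done λ v _ → stable v tt
      Stab-restrict {c} c⊆ (fire v _ deg≤ p) =
        fire v (unstable⇒∈ c c⊆ deg≤) deg≤ (Stab-restrict (topple-Positive⊆ c c⊆ deg≤) p)

    module _ {U : Pred n} (U? : ∀ v → Dec (U v)) (c : Config n) where

      StableIn⇒Positive⊆ : StableIn G U c → Positive⊆ c U
      StableIn⇒Positive⊆ (supported , _) v p with U? v
      ... | yes Uv = Uv
      ... | no ¬Uv = contradiction (subst (0 <_) (supported v ¬Uv) p) λ ()

      StableIn⇒StableOn-All : StableIn G U c → StableOn G (All G) c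
      StableIn⇒StableOn-All (supported , stable) v _ with U? v
      ... | yes Uv = stable v Uv
      ... | no ¬Uv = subst (_< deg G v) (sym (supported v ¬Uv)) (deg>0 (toSink v))

    Positive⊆⇒StableIn : ∀ {U} c → Positive⊆ c U → StableOn G (All G) c → StableIn G U c
    Positive⊆⇒StableIn c c⊆ stable =
      (λ v ¬Uv → n≤0⇒n≡0 (≮⇒≥ (¬Uv ∘ c⊆ v))) , λ v _ → stable v tt

    M-stable : ∀ c → StableOn G (All G) c → M G c
    M-stable c stable = (λ v ¬⊤ → contradiction tt ¬⊤) , stable

    -- Divisors of the idempotent.

    module Idempotents {e} (idem-e : Idempotent G e) where

      e-stable : StableOn G (All G) e
      e-stable = proj₂ (proj₁ idem-e)

      e⊞e≈e : e ⊞ e ≈ e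
      e⊞e≈e = Stab⇒≈ (proj₂ idem-e)

      C : Pred n
      C = cl G (supp G e)

      e⊆C : Positive⊆ e C
      e⊆C v p = v , p , here

      -- Divisors of e in the monoid of configurations modulo _≈_, with cofactor
      -- supported in U.  As e is idempotent, these are the elements that are
      -- invertible modulo e.
      Divides : Pred n → Config n → Set
      Divides U c = ∃ λ y → Positive⊆ y U × c ⊞ y ≈ e

      Divides-resp : ∀ {U c d} → c ≈ d → Divides U c → Divides U d
      Divides-resp c≈d (y , y⊆ , eq) = y , y⊆ , ≈-trans (⊞-congʳ y (≈-sym c≈d)) eq

      Divides-factor : ∀ {U a b} → Positive⊆ b U → Divides U (a ⊞ b) → Divides U a
      Divides-factor {a = a} {b} b⊆ (y , y⊆ , eq) =
        b ⊞ y , Positive⊆-⊞ b y b⊆ y⊆ , ≈-trans (≈-sym (CM.assoc a b y)) eq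

      module _ {U : Pred n} (e⊆U : Positive⊆ e U) where

        Divides-zero : Divides U (zeroC n)
        Divides-zero = e , e⊆U , CM.identityˡ e

        -- The cofactors add up, and the product `e ⊞ e` collapses to `e`.
        Divides-⊞ : ∀ {a b} → Divides U a → Divides U b → Divides U (a ⊞ b)
        Divides-⊞ {a} {b} (y , y⊆ , eq) (z , z⊆ , eq′) =
          y ⊞ z , Positive⊆-⊞ y z y⊆ z⊆ ,
          ≈-trans (CS.interchange a b y z) (≈-trans (⊞-cong eq eq′) e⊞e≈e)

        Divides-· : ∀ {c} k → Divides U c → Divides U (k · c)
        Divides-· zero    _   = Divides-zero
        Divides-· (suc k) div = Divides-⊞ div (Divides-· k div)

        Divides-grains : ∀ c → (∀ v → 0 < lookup c v → Divides U (δ v)) → Divides U c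
        Divides-grains = ⊞-induction (Divides U) Divides-zero Divides-⊞

        module _ (closed : Closed U) where

          -- With `δ v`, also `deg G v` copies of it divide `e`, hence so does the row of `v`, of
          -- which `δ u` is a summand. Closedness keeps the rest of the row in `U`, where cofactors
          -- must live.
          Divides-Edge : ∀ {v u} → U v → Edge G v u → Divides U (δ v) → Divides U (δ u)
          Divides-Edge {v} {u} Uv v→u div
            with remove-grain (row v) u (subst (0 <_) (sym (lookup∘tabulate (adj G v) u)) v→u)
          ... | d , row≡ = Divides-factor
            (Positive⊆-⊞⁻ʳ (δ u) d (subst (λ c → Positive⊆ c U) row≡ λ w p → closed Uv (row⇒Edge p)))
            (subst (Divides U) row≡ (Divides-resp (deg·δ≈row v) (Divides-· (deg G v) div)))

          Divides-Reach : ∀ {v u} → U v → Reach G v u → Divides U (δ v) → Divides U (δ u)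
          Divides-Reach Uv here           div = div
          Divides-Reach Uv (step v→w w⇝u) div = Divides-Reach (closed Uv v→w) w⇝u (Divides-Edge Uv v→w div)

      -- Which single grains divide the idempotent.

      Positive⊆-All : ∀ c → Positive⊆ c (All G)
      Positive⊆-All _ _ _ = tt

      C-closed : Closed C
      C-closed = cl-closed (supp G e)

      Divides-δ : ∀ {U c v} → Positive⊆ c U → Divides U c → 0 < lookup c v → Divides U (δ v)
      Divides-δ {U} {c} {v} c⊆ div p with remove-grain c v p
      ... | d , refl = Divides-factor (Positive⊆-⊞⁻ʳ (δ v) d c⊆) div

      Divides-e : ∀ {U} → Positive⊆ e U → Divides U e
      Divides-e e⊆U = e , e⊆U , e⊞e≈e

      Divides-C-δ : ∀ {v} → C v → Divides C (δ v)
      Divides-C-δ (w , p , w⇝v) = Divides-Reach e⊆C C-closed (e⊆C w p) w⇝v (Divides-δ e⊆C (Divides-e e⊆C) p)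

      Divides-C⇒Divides : ∀ {c} → Divides C c → Divides (All G) c
      Divides-C⇒Divides (y , _ , eq) = y , Positive⊆-All y , eq

      -- The row of `v` divides `e`, hence so do `deg G v` copies of `δ v`; as this number is
      -- positive, one copy is a factor.
      Divides-predecessor : ∀ {v} → (∀ u → Edge G v u → Divides (All G) (δ u)) → Divides (All G) (δ v)
      Divides-predecessor {v} div = factor (deg>0 (toSink v))
        (Divides-resp (≈-sym (deg·δ≈row v)) (Divides-grains (Positive⊆-All e) (row v) λ u p → div u (row⇒Edge p)))
        where
        factor : ∀ {k} → 0 < k → Divides (All G) (k · δ v) → Divides (All G) (δ v)
        factor {suc k} _ = Divides-factor (Positive⊆-All (k · δ v))

      SCC-meets⇒C : ∀ {v} → (∃ λ w → SameSCC G v w × supp G e w) → C v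
      SCC-meets⇒C (w , (_ , w⇝v) , p) = w , p , w⇝v

      -- If `u` were on a cycle, its component would meet the support of `e`, which would put `u` in
      -- `C`.
      successor-in-A : ∀ {v u} → A G e v → Edge G v u → ¬ C u → A G e u
      successor-in-A (_ , _ , meets) v→u ¬Cu =
        (λ cycle → ¬Cu (SCC-meets⇒C (meets _ (step v→u here) (_ , (here , here) , cycle)))) ,
        ¬Cu ,
        λ w u⇝w → meets w (step v→u u⇝w)

      Divides-A-δ : ∀ {v} → A G e v → Divides (All G) (δ v)
      Divides-A-δ {v} = go (spo-wellFounded ⊏-isStrictPartialOrder v)
        where
        go : ∀ {v} → Acc _⊏_ v → A G e v → Divides (All G) (δ v)
        go {v} (acc rs) Av = Divides-predecessor divides-successor
          where
          divides-successor : ∀ u → Edge G v u → Divides (All G) (δ u)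
          divides-successor u v→u with cl-supp? e u
          ... | yes Cu = Divides-C⇒Divides (Divides-C-δ Cu)
          -- The edge descends strictly in `⊏`, since a way back from `u` would close a cycle
          -- through `v`.
          ... | no ¬Cu = go (rs (step v→u here , λ u⇝v → proj₁ Av (u , v→u , u⇝v))) (successor-in-A Av v→u ¬Cu)

      -- `δ u ⊞ y` stabilizes to `e`, and the grain at `u` keeps its cyclic component inhabited
      -- throughout.
      Divides-δ⇒SCC-meets : ∀ {u} → CyclicSCCof G u → Divides (All G) (δ u) → ∃ λ w → SameSCC G u w × supp G e w
      Divides-δ⇒SCC-meets {u} cyclic (y , _ , eq) = Stab-Inhabited cyclic (≈⇒Stab e-stable eq)
        (u , (here , here) , subst (0 <_) (sym (trans (lookup-⊞ (δ u) y u) (cong (_+ lookup y u) (lookup-δ-self u)))) z<s)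

      Divides-δ⇒A : ∀ {v} → ¬ C v → Divides (All G) (δ v) → A G e v
      Divides-δ⇒A {v} ¬Cv div =
        (λ cycle → ¬Cv (SCC-meets⇒C (meets v here (v , (here , here) , cycle)))) , ¬Cv , meets
        where
        meets : ∀ u → Reach G v u → CyclicSCCof G u → ∃ λ w → SameSCC G u w × supp G e w
        meets u v⇝u cyclic = Divides-δ⇒SCC-meets cyclic (Divides-Reach (Positive⊆-All e) (λ _ _ → tt) tt v⇝u div)

      C? : ∀ v → Dec (C v)
      C? = cl-supp? e

      -- Absorption of the idempotent and recurrence on its closure.

      module _ {x} (x-stable : StableOn G (All G) x) (x⊞e≈x : x ⊞ e ≈ x) where

        private
          g j d : Config n
          g = restrict C? x
          j = restrict (¬? ∘ C?) x
          d = stab (g ⊞ e)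

          d⊆C : Positive⊆ d C
          d⊆C = Stab-Positive⊆ C-closed (Positive⊆-⊞ g e (restrict-Positive⊆ C? x) e⊆C) (stab-Stab (g ⊞ e))

          -- `d` lives on `C` and `j` off `C`, so at each vertex only one of two stable
          -- configurations contributes.
          d⊞j-stable : StableOn G (All G) (d ⊞ j)
          d⊞j-stable v _ = subst (_< deg G v) (sym (lookup-⊞ d j v)) (bound (C? v))
            where
            bound : Dec (C v) → lookup d v + lookup j v < deg G v
            bound (yes Cv) = subst (_< deg G v)
              (trans (sym (+-identityʳ _)) (cong (lookup d v +_) (sym (lookup-restrict-∉ (¬? ∘ C?) x λ ¬Cv → ¬Cv Cv))))
              (stab-stable (g ⊞ e) v tt)
            bound (no ¬Cv) = subst (λ k → k + lookup j v < deg G v) (sym (n≤0⇒n≡0 (≮⇒≥ (¬Cv ∘ d⊆C v))))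
              (≤-<-trans (restrict-≤ (¬? ∘ C?) x v) (x-stable v tt))

          d⊞j≈x : d ⊞ j ≈ x
          d⊞j≈x = begin
            d ⊞ j        ≈⟨ ⊞-congʳ j (stab-≈ (g ⊞ e)) ⟩
            (g ⊞ e) ⊞ j  ≈⟨ CS.xy∙z≈xz∙y g e j ⟩
            (g ⊞ j) ⊞ e  ≡⟨ cong (_⊞ e) (restrict-complement C? x) ⟩
            x ⊞ e        ≈⟨ x⊞e≈x ⟩
            x            ∎
            where open ≈-Reasoning

        -- `d ⊞ j` and `x` are stable and equivalent, hence equal; cancelling `j` from
        -- `d ⊞ j ≡ g ⊞ j` gives `d ≡ g`.
        restrict-C-absorbs : restrict C? x ⊞ e ≈ restrict C? x
        restrict-C-absorbs = subst (g ⊞ e ≈_) d≡g (≈-sym (stab-≈ (g ⊞ e)))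
          where
          d≡g : d ≡ g
          d≡g = ⊞-cancelʳ d g j (trans (Stab-unique (done d⊞j-stable) (≈⇒Stab x-stable d⊞j≈x))
                                       (sym (restrict-complement C? x)))

      absorbs⇒Recurrent : ∀ {g} → Positive⊆ g C → StableOn G (All G) g → g ⊞ e ≈ g → RecurrentIn G C g
      absorbs⇒Recurrent {g} g⊆C g-stable g⊞e≈g = Positive⊆⇒StableIn g g⊆C g-stable , λ b b∈ → access b (StableIn⇒Positive⊆ C? b b∈)
        where
        access : ∀ b → Positive⊆ b C → ∃ λ x → StableIn G C x × Stab G C (b ⊞ x) g
        access b b⊆C with Divides-grains e⊆C b (λ v p → Divides-C-δ (b⊆C v p))
        ... | y , y⊆C , b⊞y≈e =
          x , Positive⊆⇒StableIn x x⊆C (stab-stable (y ⊞ g)) ,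
          Stab-restrict C-closed (Positive⊆-⊞ b x b⊆C x⊆C) (≈⇒Stab g-stable b⊞x≈g)
          where
          -- The cofactor `y` turns `b` into `e`, which `g` then absorbs.
          x = stab (y ⊞ g)
          x⊆C : Positive⊆ x C
          x⊆C = Stab-Positive⊆ C-closed (Positive⊆-⊞ y g y⊆C g⊆C) (stab-Stab (y ⊞ g))
          b⊞x≈g : b ⊞ x ≈ g
          b⊞x≈g = begin
            b ⊞ x        ≈⟨ CM.∙-congˡ (stab-≈ (y ⊞ g)) ⟩
            b ⊞ (y ⊞ g)  ≈⟨ CM.assoc b y g ⟨
            (b ⊞ y) ⊞ g  ≈⟨ ⊞-congʳ g b⊞y≈e ⟩
            e ⊞ g        ≈⟨ CM.comm e g ⟩
            g ⊞ e        ≈⟨ g⊞e≈g ⟩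
            g            ∎
            where open ≈-Reasoning

      -- Being accessible from `e`, `g` has the form `e ⊞ x`, and a second `e` merges with the
      -- first.
      Recurrent⇒absorbs : ∀ {g} → RecurrentIn G C g → g ⊞ e ≈ g
      Recurrent⇒absorbs {g} (g∈ , access) with access e (Positive⊆⇒StableIn e e⊆C e-stable)
      ... | x , _ , p = begin
        g ⊞ e        ≈⟨ ⊞-congʳ e e⊞x≈g ⟨
        (e ⊞ x) ⊞ e  ≈⟨ CS.xy∙z≈xz∙y e x e ⟩
        (e ⊞ e) ⊞ x  ≈⟨ ⊞-congʳ x e⊞e≈e ⟩
        e ⊞ x        ≈⟨ e⊞x≈g ⟩
        g            ∎
        where
        open ≈-Reasoning
        e⊞x≈g : e ⊞ x ≈ g
        e⊞x≈g = Stab⇒≈ (Stab-extend (StableIn⇒StableOn-All C? g g∈) p)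

      -- The maximal subgroup as a group of units, and its decomposition.

      Unit : Config n → Set
      Unit x = M G x × x ⊞ e ≈ x × Divides (All G) x

      Unit-isSubgroup : IsSubgroupWithId G e Unit
      Unit-isSubgroup =
          (λ _ → proj₁)
        , (proj₁ idem-e , e⊞e≈e , Divides-e (Positive⊆-All e))
        , product-closed
        , (λ { x (Mx , x⊞e≈x , _) → ≈⇒Stab (proj₂ Mx) x⊞e≈x })
        , inverse
        where
        open ≈-Reasoning
        product-closed : ∀ x y z → Unit x → Unit y → Oplus G x y z → Unit z
        product-closed x y z (_ , _ , x∣e) (_ , y⊞e≈y , y∣e) p =
          M-stable z (Stab-stable p) , z⊞e≈z , Divides-resp (Stab⇒≈ p) (Divides-⊞ (Positive⊆-All e) x∣e y∣e)
          where
          z⊞e≈z : z ⊞ e ≈ z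
          z⊞e≈z = begin
            z ⊞ e        ≈⟨ ⊞-congʳ e (Stab⇒≈ p) ⟨
            (x ⊞ y) ⊞ e  ≈⟨ CM.assoc x y e ⟩
            x ⊞ (y ⊞ e)  ≈⟨ CM.∙-congˡ y⊞e≈y ⟩
            x ⊞ y        ≈⟨ Stab⇒≈ p ⟩
            z            ∎
        inverse : ∀ x → Unit x → ∃ λ y → Unit y × Oplus G x y e
        inverse x (Mx , x⊞e≈x , y , _ , x⊞y≈e) =
          z , (M-stable z (stab-stable (y ⊞ e)) , z⊞e≈z , x , Positive⊆-All x , ≈-trans (CM.comm z x) x⊞z≈e) ,
          ≈⇒Stab e-stable x⊞z≈e
          where
          -- Adding `e` to the cofactor makes it absorb `e`, as an element of the group must.
          z = stab (y ⊞ e)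
          z⊞e≈z : z ⊞ e ≈ z
          z⊞e≈z = begin
            z ⊞ e        ≈⟨ ⊞-congʳ e (stab-≈ (y ⊞ e)) ⟩
            (y ⊞ e) ⊞ e  ≈⟨ CM.assoc y e e ⟩
            y ⊞ (e ⊞ e)  ≈⟨ CM.∙-congˡ e⊞e≈e ⟩
            y ⊞ e        ≈⟨ stab-≈ (y ⊞ e) ⟨
            z            ∎
          x⊞z≈e : x ⊞ z ≈ e
          x⊞z≈e = begin
            x ⊞ z        ≈⟨ CM.∙-congˡ (stab-≈ (y ⊞ e)) ⟩
            x ⊞ (y ⊞ e)  ≈⟨ CM.assoc x y e ⟨
            (x ⊞ y) ⊞ e  ≈⟨ ⊞-congʳ e x⊞y≈e ⟩
            e ⊞ e        ≈⟨ e⊞e≈e ⟩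
            e            ∎

      -- An inverse in `H` is a cofactor, so every subgroup with identity `e` lies in `Unit`.
      subgroup⇒Unit : ∀ {H} → IsSubgroupWithId G e H → ∀ {x} → H x → Unit x
      subgroup⇒Unit (H⊆M , _ , _ , identity , inverse) {x} Hx with inverse x Hx
      ... | y , _ , p = H⊆M x Hx , Stab⇒≈ (identity x Hx) , y , Positive⊆-All y , Stab⇒≈ p

      Decomposition : Config n → Set
      Decomposition x = ∃ λ g → ∃ λ j → M G g × M G j × RecurrentIn G C g
                          × (∀ v → supp G j v → A G e v) × Oplus G g j x

      Unit⇒Decomposition : ∀ {x} → Unit x → Decomposition x
      Unit⇒Decomposition {x} ((_ , x-stable) , x⊞e≈x , x∣e) =
        g , j , M-stable g g-stable , M-stable j (λ v _ → ≤-<-trans (restrict-≤ (¬? ∘ C?) x v) (x-stable v tt)) ,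
        absorbs⇒Recurrent (restrict-Positive⊆ C? x) g-stable (restrict-C-absorbs x-stable x⊞e≈x) ,
        (λ v p → Divides-δ⇒A (restrict-Positive⊆ (¬? ∘ C?) x v p)
                   (Divides-δ (Positive⊆-All x) x∣e (<-≤-trans p (restrict-≤ (¬? ∘ C?) x v)))) ,
        subst (λ c → Stab G (All G) c x) (sym (restrict-complement C? x)) (done x-stable)
        where
        g = restrict C? x
        j = restrict (¬? ∘ C?) x
        g-stable : StableOn G (All G) g
        g-stable v _ = ≤-<-trans (restrict-≤ C? x v) (x-stable v tt)

      Decomposition⇒Unit : ∀ {x} → Decomposition x → Unit x
      Decomposition⇒Unit {x} (g , j , _ , _ , recurrent , j⊆A , p) =
        M-stable x (Stab-stable p) , x⊞e≈x ,
        Divides-resp (Stab⇒≈ p) (Divides-⊞ (Positive⊆-All e)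
          (Divides-grains (Positive⊆-All e) g λ v q → Divides-C⇒Divides (Divides-C-δ (StableIn⇒Positive⊆ C? g (proj₁ recurrent) v q)))
          (Divides-grains (Positive⊆-All e) j λ v q → Divides-A-δ (j⊆A v q)))
        where
        open ≈-Reasoning
        x⊞e≈x : x ⊞ e ≈ x
        x⊞e≈x = begin
          x ⊞ e        ≈⟨ ⊞-congʳ e (Stab⇒≈ p) ⟨
          (g ⊞ j) ⊞ e  ≈⟨ CS.xy∙z≈xz∙y g j e ⟩
          (g ⊞ e) ⊞ j  ≈⟨ ⊞-congʳ j (Recurrent⇒absorbs recurrent) ⟩
          g ⊞ j        ≈⟨ Stab⇒≈ p ⟩
          x            ∎

theorem3p6 : ∀ {n} (G : Graph n) → IsSandpileGraph G →
    ∀ (e : Config n) → Idempotent G e → e ≢ zeroC n →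
    ∀ (Ge : Config n → Set) → IsMaximalSubgroupWithId G e Ge →
    ∀ (x : Config n) →
    Ge x ⇔ (∃ λ g → ∃ λ j → M G g × M G j
    × RecurrentIn G (cl G (supp G e)) g
    × (∀ v → supp G j v → A G e v)
    × Oplus G g j x)
theorem3p6 G (_ , toSink) e idem-e _ Ge (subgroup , maximal) x =
  -- `Ge` is a subgroup and so lies in `Unit`; `Unit` is a subgroup and so lies in `Ge` by
  -- maximality.
  mk⇔ (λ Gx → Unit⇒Decomposition (subgroup⇒Unit subgroup Gx))
      (λ dec → maximal Unit Unit-isSubgroup x (Decomposition⇒Unit dec))
  where
  open Stabilization G toSink
  open Idempotents idem-e
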